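{- Let $f\ge 0$ and $n\ge 2f+1$ be integers. Then $S_d(n,f)\le 9d$; that is, there is a search algorithm for $n$ robots, at most $f$ of which are byzantine faulty, whose search time for a target at (unknown) distance $d$ from the origin is at most $9d$, for every $d>0$.
   Context: Model. $n$ robots with distinct identities start at time $0$ at the origin of the real line and move along the line with speed at most $1$, changing direction or speed at no cost. A target lies at an unknown point at distance $d>0$ from the origin, i.e. at $d$ or $-d$, with $d$ unknown to the robots. At most $f$ robots are faulty; the bound $f$ is known, but not which robots are faulty. A search algorithm assigns each robot a trajectory, known to all robots; a robot's further motion may depend on the messages broadcast so far (computation and communication take no time). A robot detects whether the target is at a point only by being there. The only messages are announcements "the target is here", heard instantly by all robots at any distance; each message automatically carries the true identity and true current location of its sender. A robot visiting a point silently is taken to claim that the target is not there. Reliable (non-faulty) robots follow the algorithm and report truthfully. Faulty robots are controlled by an adversary: they may stay silent at the target or announce the target where it is not; a faulty robot that broadcasts while off its assigned trajectory is thereby detected as faulty. The search is completed at the first time when some reliable robot has visited the target and announced it and all reliable robots can be certain of its location (every scenario with at most $f$ faulty robots consistent with the messages so far has the target at that location). For an algorithm, the search time $S_d(n,f)$ is the worst-case completion time over both positions $\pm d$ of the target, all choices of at most $f$ faulty robots, and all behaviours of the faulty robots. The inequality $S_d(n,f)\le cd$ means that there is an algorithm, not depending on $d$, with search time at most $cd$ for every $d>0$. -}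

module Defs where

open import Algebra.Structures using (IsCommutativeRing)
open import Data.Bool.Base using (Bool; true; if_then_else_)
open import Data.Fin.Base using (Fin)
open import Data.Fin.Subset using (Subset; _∈_; _∉_; ∣_∣)
open import Data.Maybe.Base using (Maybe; just; nothing)
open import Data.Nat.Base as ℕ using (ℕ; zero; suc)
open import Data.Product.Base using (Σ; ∃; _×_)
open import Data.Sum.Base using (_⊎_)
open import Function.Bundles using (_⇔_)
open import Relation.Binary.Core using (Rel)
open import Relation.Binary.PropositionalEquality.Core using (_≡_; _≢_)
open import Relation.Binary.Structures using (IsStrictTotalOrder)
import Relation.Binary.Construct.StrictToNonStrict as StrictToNonStrict

-- The real numbers, characterised (uniquely up to isomorphism) as a complete
-- ordered field.  `supremum` asks the least upper bound s to be approximated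
-- from within P; classically this is the same as being ≤ every upper bound.
-- Together with trichotomy it yields the Archimedean property with witnesses,
-- and excluded middle for Set (take the supremum of {0} ∪ {1 | Q}), so these
-- are the classical real numbers.
record RealNumbers : Set₁ where
  infix  8 -_
  infixl 7 _*_
  infixl 6 _+_ _-_
  infix  4 _<_
  field
    Carrier            : Set
    _+_ _*_            : Carrier → Carrier → Carrier
    -_                 : Carrier → Carrier
    0# 1#              : Carrier
    _<_                : Rel Carrier _
    isCommutativeRing  : IsCommutativeRing _≡_ _+_ _*_ -_ 0# 1#
    0≢1                : 0# ≢ 1#
    inverse            : ∀ x → x ≢ 0# → ∃ λ y → x * y ≡ 1#
    isStrictTotalOrder : IsStrictTotalOrder _≡_ _<_
    +-monoˡ-<          : ∀ z {x y} → x < y → x + z < y + z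
    *-positive         : ∀ {x y} → 0# < x → 0# < y → 0# < x * y

  open StrictToNonStrict {A = Carrier} _≡_ _<_ public using (_≤_)

  UpperBound : (Carrier → Set) → Carrier → Set
  UpperBound P u = ∀ x → P x → x ≤ u

  field
    supremum : ∀ (P : Carrier → Set) → ∃ P → ∃ (UpperBound P) →
               ∃ λ s → UpperBound P s × (∀ y → y < s → ∃ λ x → P x × y < x)

  _-_ : Carrier → Carrier → Carrier
  x - y = x + (- y)

  fromℕ : ℕ → Carrier
  fromℕ zero    = 0#
  fromℕ (suc n) = 1# + fromℕ n

module Search (R : RealNumbers) where
  open RealNumbers R renaming (Carrier to ℝ)

  -- Times range over ℝ, but everything below only looks at times t with 0 ≤ t.

  record IsTrajectory (x : ℝ → ℝ) : Set where
    field
      origin : x 0# ≡ 0#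
      speed  : ∀ {s t} → 0# ≤ s → s ≤ t →
               (- (t - s) ≤ x t - x s) × (x t - x s ≤ t - s)

  -- H i t is `just p` when robot i broadcasts "the target is here" at time t,
  -- being at point p, and `nothing` when it is silent at time t.
  Transcript : ℕ → Set
  Transcript n = Fin n → ℝ → Maybe ℝ

  AgreeUpTo : ∀ {n} → ℝ → Transcript n → Transcript n → Set
  AgreeUpTo t H H′ = ∀ i s → 0# ≤ s → s ≤ t → H i s ≡ H′ i s

  -- The trajectories assigned to the robots, in dependence on the messages.
  record Strategy (n : ℕ) : Set where
    field
      assigned     : Transcript n → Fin n → ℝ → ℝ
      isTrajectory : ∀ H i → IsTrajectory (assigned H i)
      causal       : ∀ {H H′ t} → 0# ≤ t → AgreeUpTo t H H′ →
                     ∀ i → assigned H i t ≡ assigned H′ i t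

  -- Identities and locations in messages cannot be forged: the location in a
  -- message is the sender's actual position, also for a faulty robot.
  record Scenario (n : ℕ) : Set where
    field
      target    : ℝ
      faulty    : Subset n
      motion    : Fin n → ℝ → ℝ
      announces : Fin n → ℝ → Bool

    transcript : Transcript n
    transcript i t = if announces i t then just (motion i t) else nothing

  -- Faulty robots are constrained only by the initial position and the speed
  -- limit: they may leave their assigned trajectory and announce at any time.
  record IsRun {n} (f : ℕ) (A : Strategy n) (σ : Scenario n) : Set where
    open Strategy A using (assigned)
    open Scenario σ
    field
      target≢0     : target ≢ 0#
      faulty≤f     : ∣ faulty ∣ ℕ.≤ f
      isTrajectory : ∀ i → IsTrajectory (motion i)
      follows      : ∀ {i} → i ∉ faulty → ∀ {t} → 0# ≤ t →
                     motion i t ≡ assigned transcript i t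
      truthful     : ∀ {i} → i ∉ faulty → ∀ {t} → 0# ≤ t →
                     announces i t ≡ true ⇔ motion i t ≡ target

  -- In continuous time the mutual dependence of motions and messages need not
  -- have a solution for every causal strategy, so that a bound on all runs
  -- could hold for lack of runs.  An algorithm is required to have a run
  -- against every target, every set of faulty robots and every behaviour
  -- (motions m, announcement times a) of these.
  WellPosed : ∀ {n} → ℕ → Strategy n → Set
  WellPosed {n} f A =
    ∀ (x : ℝ) → x ≢ 0# → (F : Subset n) → ∣ F ∣ ℕ.≤ f →
    (m : Fin n → ℝ → ℝ) (a : Fin n → ℝ → Bool) → (∀ i → IsTrajectory (m i)) →
    Σ (Scenario n) λ σ → let open Scenario σ in
      IsRun f A σ × target ≡ x × faulty ≡ F ×
      (∀ i → i ∈ F → ∀ t → 0# ≤ t → motion i t ≡ m i t × announces i t ≡ a i t)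

  record Algorithm (n f : ℕ) : Set where
    field
      strategy  : Strategy n
      wellPosed : WellPosed f strategy

  module _ {n f : ℕ} (A : Algorithm n f) where
    open Algorithm A
    open Scenario

    Certain : Scenario n → ℝ → Set
    Certain σ T = ∀ σ′ → IsRun f strategy σ′ →
                  AgreeUpTo T (transcript σ) (transcript σ′) →
                  target σ′ ≡ target σ

    Found : Scenario n → ℝ → Set
    Found σ T = ∃ λ i → ∃ λ t → i ∉ faulty σ × 0# ≤ t × t ≤ T ×
                motion σ i t ≡ target σ × announces σ i t ≡ true

    Completed : Scenario n → ℝ → Set
    Completed σ T = Found σ T × Certain σ T

    -- Worst-case completion time at most b; `Completed σ` is upward closed.
    SearchTimeAtMost : ℝ → ℝ → Set
    SearchTimeAtMost d b =
      ∀ σ → IsRun f strategy σ → target σ ≡ d ⊎ target σ ≡ - d →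
      ∃ λ T → T ≤ b × Completed σ T

  -- S_d(n,f) ≤ c d, with one algorithm for all d.
  S[_,_]≤_·d : ℕ → ℕ → ℝ → Set
  S[ n , f ]≤ c ·d =
    Σ (Algorithm n f) λ A → ∀ d → 0# < d → SearchTimeAtMost A d (c * d)

{-# OPTIONS --safe #-}
module Submission where

-- All robots move together on one zigzag with turning points 4ʲ at time 3·4ʲ
-- and - 2·4ʲ at time 6·4ʲ, for all integers j, which visits both points at
-- distance d by time 9d.  At such a visit at least f + 1 reliable robots
-- announce the target at once, and they cannot all be faulty in another
-- scenario with the same messages.
--
-- The zigzag is the least 1-Lipschitz function through its right turning
-- points, t ↦ sup_r (r - |t - 3r|) over r = 4ʲ: two consecutive tents meet
-- exactly at the left turning point between them.  As r - |t - 3r| is the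
-- minimum of t - 2r and 4r - t, no absolute values are needed.  Admitting
-- r = 0 as well makes the value at t = 0 evident.

open import Defs
open import Algebra.Bundles using (CommutativeRing)
import Algebra.Properties.Ring as RingProperties
import Algebra.Solver.Ring.NaturalCoefficients.Default as NaturalCoefficients
open import Data.Bool.Base using (true; if_then_else_)
open import Data.Empty using (⊥-elim)
open import Data.Fin.Base using (zero; suc)
open import Data.Fin.Subset using (Subset; inside; outside; _∈_; _∉_; ∣_∣)
open import Data.Fin.Subset.Properties using (_∈?_; ∣p∣≤∣x∷p∣)
open import Data.Integer.Base using (ℤ; -[1+_]; -≤-; -≤+; +≤+)
import Data.Integer.Base as ℤ
import Data.Integer.Properties as ℤ
open import Data.Maybe.Base using (Maybe; just; nothing)
open import Data.Nat.Base as ℕ using (ℕ)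
import Data.Nat.Properties as ℕ
open import Data.Product.Base using (∃; _×_; _,_; proj₁; proj₂)
open import Data.Sum.Base using (_⊎_; inj₁; inj₂)
open import Data.Vec.Base using ([]; _∷_; here; there)
open import Function.Base using (case_of_)
open import Function.Bundles using (_⇔_; mk⇔; Equivalence)
open import Relation.Binary.Definitions using (tri<; tri≈; tri>)
open import Relation.Binary.PropositionalEquality
  using (_≡_; refl; sym; trans; cong; subst; subst₂; module ≡-Reasoning)
open import Relation.Binary.Structures using (IsStrictTotalOrder; IsTotalOrder)
import Relation.Binary.Construct.StrictToNonStrict as StrictToNonStrict
open import Relation.Nullary using (¬_; yes; no; does)
open import Relation.Nullary.Decidable using (dec-true; dec-false)

-- Two subsets too small to cover a finite set.

outside-both : ∀ {n} (p q : Subset n) → ∣ p ∣ ℕ.+ ∣ q ∣ ℕ.< n → ∃ λ i → i ∉ p × i ∉ q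
outside-both (outside ∷ p) (outside ∷ q) _ = zero , (λ ()) , λ ()
-- The discarded head is paid for by `p`, whether or not `q` contains it too.
outside-both (inside ∷ p) (s ∷ q) lt
  with i , i∉p , i∉q ← outside-both p q (ℕ.<-≤-trans
         (ℕ.s≤s (ℕ.+-monoʳ-≤ ∣ p ∣ (∣p∣≤∣x∷p∣ s q))) (ℕ.s≤s⁻¹ lt))
  = suc i , (λ { (there h) → i∉p h }) , λ { (there h) → i∉q h }
outside-both {ℕ.suc n} (outside ∷ p) (inside ∷ q) lt
  with i , i∉p , i∉q ← outside-both p q (subst (ℕ._≤ n) (ℕ.+-suc ∣ p ∣ ∣ q ∣) (ℕ.s≤s⁻¹ lt))
  = suc i , (λ { (there h) → i∉p h }) , λ { (there h) → i∉q h }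

-- Ordered-field arithmetic.

module OrderedField (R : RealNumbers) where
  open RealNumbers R public renaming (Carrier to ℝ)
  open IsStrictTotalOrder isStrictTotalOrder public
    using (compare; _≟_) renaming (trans to <-trans; irrefl to <-irrefl)
  open IsTotalOrder (StrictToNonStrict.isTotalOrder _≡_ _<_ isStrictTotalOrder) public
    using () renaming (refl to ≤-refl; reflexive to ≤-reflexive; trans to ≤-trans;
                       antisym to ≤-antisym; total to ≤-total)

  commutativeRing : CommutativeRing _ _
  commutativeRing = record { isCommutativeRing = isCommutativeRing }

  open CommutativeRing commutativeRing public
    using (ring; commutativeSemiring; +-identityˡ; +-identityʳ; *-identityˡ;
           zeroʳ; +-comm; *-assoc; -‿inverseˡ; -‿inverseʳ)
  open RingProperties ring public using (-‿distribʳ-*; -1*x≈-x; -‿involutive; ⁻¹-anti-homo-//)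
  open NaturalCoefficients commutativeSemiring public using (solve; con; _:+_; _:*_; _:=_)

  <-≤-trans : ∀ {x y z} → x < y → y ≤ z → x < z
  <-≤-trans x<y (inj₁ y<z) = <-trans x<y y<z
  <-≤-trans x<y (inj₂ refl) = x<y

  ≤-<-trans : ∀ {x y z} → x ≤ y → y < z → x < z
  ≤-<-trans (inj₁ x<y) y<z = <-trans x<y y<z
  ≤-<-trans (inj₂ refl) y<z = y<z

  <⇒≱ : ∀ {x y} → x < y → ¬ y ≤ x
  <⇒≱ x<y y≤x = <-irrefl refl (<-≤-trans x<y y≤x)

  <-≤-connex : ∀ x y → x < y ⊎ y ≤ x
  <-≤-connex x y with compare x y
  ... | tri< x<y _ _ = inj₁ x<y
  ... | tri≈ _ x≡y _ = inj₂ (inj₂ (sym x≡y))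
  ... | tri> _ _ y<x = inj₂ (inj₁ y<x)

  ≮⇒≥ : ∀ {x y} → ¬ x < y → y ≤ x
  ≮⇒≥ {x} {y} x≮y with <-≤-connex x y
  ... | inj₁ x<y = ⊥-elim (x≮y x<y)
  ... | inj₂ y≤x = y≤x

  +-monoʳ-< : ∀ z {x y} → x < y → z + x < z + y
  +-monoʳ-< z x<y = subst₂ _<_ (+-comm _ z) (+-comm _ z) (+-monoˡ-< z x<y)

  +-mono-< : ∀ {a b c d} → a < b → c < d → a + c < b + d
  +-mono-< {b = b} {c} a<b c<d = <-trans (+-monoˡ-< c a<b) (+-monoʳ-< b c<d)

  +-mono-≤ : ∀ {a b c d} → a ≤ b → c ≤ d → a + c ≤ b + d
  +-mono-≤ (inj₁ a<b) (inj₁ c<d) = inj₁ (+-mono-< a<b c<d)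
  +-mono-≤ (inj₁ a<b) (inj₂ refl) = inj₁ (+-monoˡ-< _ a<b)
  +-mono-≤ (inj₂ refl) (inj₁ c<d) = inj₁ (+-monoʳ-< _ c<d)
  +-mono-≤ (inj₂ refl) (inj₂ refl) = inj₂ refl

  -- The equation says b - a ≡ d - c; it has no subtraction, so the solver
  -- for commutative semirings applies to it.
  ≤-by : ∀ {a b c d} → a ≤ b → c + b ≡ a + d → c ≤ d
  ≤-by {a} {b} {c} {d} a≤b eq = ≮⇒≥ λ d<c →
    <-irrefl (sym eq) (<-≤-trans (+-monoʳ-< a d<c)
      (subst (_≤ c + b) (+-comm c a) (+-mono-≤ (≤-refl {c}) a≤b)))

  <-by : ∀ {a b c d} → a < b → c + b ≡ a + d → c < d
  <-by {a} {b} {c} {d} a<b eq with <-≤-connex c d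
  ... | inj₁ c<d = c<d
  ... | inj₂ d≤c = ⊥-elim (<-irrefl (sym eq)
    (≤-<-trans (+-mono-≤ (≤-refl {a}) d≤c)
      (subst (a + c <_) (+-comm b c) (+-monoˡ-< c a<b))))

  x-y+y≡x : ∀ x y → x - y + y ≡ x
  x-y+y≡x x y = begin
    x - y + y     ≡⟨ solve 3 (λ x n y → x :+ n :+ y := x :+ (n :+ y)) refl x (- y) y ⟩
    x + (- y + y) ≡⟨ cong (x +_) (-‿inverseˡ y) ⟩
    x + 0#        ≡⟨ +-identityʳ x ⟩
    x             ∎
    where open ≡-Reasoning

  ≤⇒≤-sub : ∀ {a b c} → a + b ≤ c → a ≤ c - b
  -- The solver treats `c - b` as an atom `u`; the one fact about it, `u + b ≡ c`, enters as a
  -- summand of the inequality.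
  ≤⇒≤-sub {a} {b} {c} h = ≤-by (+-mono-≤ h (≤-reflexive (sym (x-y+y≡x c b))))
    (solve 4 (λ a b c u → a :+ (c :+ (u :+ b)) := a :+ b :+ c :+ u) refl a b c (c - b))

  difference-≤ : ∀ {a b c d} → a + d ≤ c + b → a - b ≤ c - d
  difference-≤ {a} {b} {c} {d} h = ≤⇒≤-sub (≤-by
    (+-mono-≤ h (≤-reflexive (x-y+y≡x a b)))
    (solve 5 (λ a b c d u → u :+ d :+ (c :+ b :+ a) := a :+ d :+ (u :+ b) :+ c) refl a b c d (a - b)))

  4# : ℝ
  4# = 1# + 1# + 1# + 1#

  0<1 : 0# < 1#
  0<1 with compare 0# 1#
  ... | tri< 0<1 _ _ = 0<1
  ... | tri≈ _ 0≡1 _ = ⊥-elim (0≢1 0≡1)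
  -- If `1# < 0#`, then `- 1#` is positive and so is its square, which is `1#`.
  ... | tri> _ _ 1<0 = ⊥-elim (<⇒≱ 1<0 (inj₁ (subst (0# <_) -1*-1≡1 (*-positive 0<-1 0<-1))))
    where
    0<-1 : 0# < - 1#
    0<-1 = subst₂ _<_ (-‿inverseʳ 1#) (+-identityˡ (- 1#)) (+-monoˡ-< (- 1#) 1<0)
    -1*-1≡1 : - 1# * - 1# ≡ 1#
    -1*-1≡1 = trans (-1*x≈-x (- 1#)) (-‿involutive 1#)

  4*-mono-< : ∀ {a b} → a < b → 4# * a < 4# * b
  4*-mono-< {a} {b} h = <-by (+-mono-< (+-mono-< (+-mono-< h h) h) h)
    (solve 2 (λ a b → con 4 :* a :+ (b :+ b :+ b :+ b) := a :+ a :+ a :+ a :+ con 4 :* b) refl a b)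

  4*-mono-≤ : ∀ {a b} → a ≤ b → 4# * a ≤ 4# * b
  4*-mono-≤ (inj₁ a<b) = inj₁ (4*-mono-< a<b)
  4*-mono-≤ (inj₂ refl) = inj₂ refl

  4*-cancel-< : ∀ {a b} → 4# * a < 4# * b → a < b
  4*-cancel-< {a} {b} h with <-≤-connex a b
  ... | inj₁ a<b = a<b
  ... | inj₂ b≤a = ⊥-elim (<⇒≱ h (4*-mono-≤ b≤a))

  4*-cancel-≤ : ∀ {a b} → 4# * a ≤ 4# * b → a ≤ b
  4*-cancel-≤ h = ≮⇒≥ λ b<a → <⇒≱ (4*-mono-< b<a) h

  x<4*x : ∀ {x} → 0# < x → x < 4# * x
  x<4*x {x} h = <-by (+-mono-< (+-mono-< h h) h)
    (solve 1 (λ x → x :+ (x :+ x :+ x) := con 0 :+ con 0 :+ con 0 :+ con 4 :* x) refl x)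

  4*x<x : ∀ {x} → x < 0# → 4# * x < x
  4*x<x {x} h = <-by (+-mono-< (+-mono-< h h) h)
    (solve 1 (λ x → con 4 :* x :+ (con 0 :+ con 0 :+ con 0) := x :+ x :+ x :+ x) refl x)

  0<4 : 0# < 4#
  0<4 = <-by (+-mono-< (+-mono-< (+-mono-< 0<1 0<1) 0<1) 0<1)
    (solve 0 (con 0 :+ con 4 := con 0 :+ con 0 :+ con 0 :+ con 0 :+ con 4) refl)

  ¼ : ℝ
  ¼ = proj₁ (inverse 4# λ 4≡0 → <-irrefl (sym 4≡0) 0<4)

  4*¼≡1 : 4# * ¼ ≡ 1#
  4*¼≡1 = proj₂ (inverse 4# λ 4≡0 → <-irrefl (sym 4≡0) 0<4)

  4*¼*x≡x : ∀ x → 4# * (¼ * x) ≡ x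
  4*¼*x≡x x = trans (sym (*-assoc 4# ¼ x)) (trans (cong (_* x) 4*¼≡1) (*-identityˡ x))

  -- Integer powers of 4.

  pow : ℤ → ℝ
  pow (ℤ.+ ℕ.zero)      = 1#
  pow (ℤ.+ ℕ.suc n)     = 4# * pow (ℤ.+ n)
  pow -[1+ ℕ.zero ]   = ¼
  pow -[1+ ℕ.suc n ]  = ¼ * pow -[1+ n ]

  pow-suc : ∀ k → pow (ℤ.suc k) ≡ 4# * pow k
  pow-suc (ℤ.+ n)            = refl
  pow-suc -[1+ ℕ.zero ]    = sym 4*¼≡1
  pow-suc -[1+ ℕ.suc n ]   = sym (4*¼*x≡x (pow -[1+ n ]))

  4*-positive⁻ : ∀ {x} → 0# < 4# * x → 0# < x
  4*-positive⁻ {x} h = 4*-cancel-< (subst (_< 4# * x) (sym (zeroʳ 4#)) h)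

  pow-positive : ∀ k → 0# < pow k
  pow-positive (ℤ.+ ℕ.zero)      = 0<1
  pow-positive (ℤ.+ ℕ.suc n)     = *-positive 0<4 (pow-positive (ℤ.+ n))
  pow-positive -[1+ ℕ.zero ]   = 4*-positive⁻ (subst (0# <_) (sym 4*¼≡1) 0<1)
  pow-positive -[1+ ℕ.suc n ]  =
    4*-positive⁻ (subst (0# <_) (sym (4*¼*x≡x _)) (pow-positive -[1+ n ]))

  pow≤pow-suc : ∀ k → pow k ≤ pow (ℤ.suc k)
  pow≤pow-suc k = subst (pow k ≤_) (sym (pow-suc k)) (inj₁ (x<4*x (pow-positive k)))

  1≤pow⁺ : ∀ n → 1# ≤ pow (ℤ.+ n)
  1≤pow⁺ ℕ.zero    = ≤-refl
  1≤pow⁺ (ℕ.suc n) = ≤-trans (1≤pow⁺ n) (pow≤pow-suc (ℤ.+ n))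

  pow⁻≤¼ : ∀ n → pow -[1+ n ] ≤ ¼
  pow⁻≤¼ ℕ.zero    = ≤-refl
  pow⁻≤¼ (ℕ.suc n) = ≤-trans (pow≤pow-suc -[1+ ℕ.suc n ]) (pow⁻≤¼ n)

  pow-mono-≤ : ∀ {i j} → i ℤ.≤ j → pow i ≤ pow j
  pow-mono-≤ (+≤+ {n = n} ℕ.z≤n) = 1≤pow⁺ n
  pow-mono-≤ (+≤+ (ℕ.s≤s m≤n))   = 4*-mono-≤ (pow-mono-≤ (+≤+ m≤n))
  pow-mono-≤ (-≤- {m} ℕ.z≤n)     = pow⁻≤¼ m
  pow-mono-≤ (-≤- (ℕ.s≤s n≤m))   =
    4*-cancel-≤ (subst₂ _≤_ (sym (4*¼*x≡x _)) (sym (4*¼*x≡x _)) (pow-mono-≤ (-≤- n≤m)))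
  pow-mono-≤ (-≤+ {m} {n})       =
    ≤-trans (pow⁻≤¼ m) (≤-trans (pow≤pow-suc -[1+ 0 ]) (1≤pow⁺ n))

  -- Integer exponents satisfy j ≤ i or i + 1 ≤ j. This splits the tents into earlier and later ones
  -- when the zigzag is bounded from above.
  pow-gap : ∀ i j → pow j ≤ pow i ⊎ 4# * pow i ≤ pow j
  pow-gap i j with j ℤ.≤? i
  ... | yes j≤i = inj₁ (pow-mono-≤ j≤i)
  ... | no  j≰i = inj₂ (subst (_≤ pow j) (pow-suc i)
                         (pow-mono-≤ (ℤ.i<j⇒suc[i]≤j (ℤ.≰⇒> j≰i))))

  neg-mono-≤ : ∀ {a b} → a ≤ b → - b ≤ - a
  neg-mono-≤ {a} {b} h = ≤-by h (trans (-‿inverseˡ b) (sym (-‿inverseʳ a)))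

  neg<0 : ∀ {x} → 0# < x → - x < 0#
  neg<0 {x} h = <-by h (trans (-‿inverseˡ x) (sym (+-identityˡ 0#)))

  -- An upper bound `u < s` would be exceeded by some element of `P`, by approximation from within.
  sup-least : ∀ {P : ℝ → Set} {s u} → (∀ y → y < s → ∃ λ x → P x × y < x) →
              UpperBound P u → s ≤ u
  sup-least {u = u} approximated bound = ≮⇒≥ λ u<s →
    case approximated u u<s of λ (x , Px , u<x) → <⇒≱ u<x (bound x Px)

  ¼*x<x : ∀ {x} → 0# < x → ¼ * x < x
  ¼*x<x {x} 0<x = subst (¼ * x <_) (4*¼*x≡x x)
    (x<4*x (4*-positive⁻ (subst (0# <_) (sym (4*¼*x≡x x)) 0<x)))

  -- Just below the supremum of the powers ≤ y there is a power whose successor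
  -- exceeds y.  Below 1 the infimum of the powers ≥ y is used instead, so that
  -- the set at hand is again visibly nonempty.
  pow-cover-≥1 : ∀ {y} → 1# ≤ y → ∃ λ k → pow k ≤ y × y ≤ 4# * pow k
  pow-cover-≥1 {y} 1≤y = case approximated (¼ * s) (¼*x<x (<-≤-trans 0<1 (bound 1# 1∈P))) of
    λ { (_ , (k , refl , pow-k≤y) , ¼*s<pow-k) → k , pow-k≤y , ≮⇒≥ λ 4pow-k<y →
        <⇒≱ (subst (_< 4# * pow k) (4*¼*x≡x s) (4*-mono-< ¼*s<pow-k))
            (bound (4# * pow k) (ℤ.suc k , sym (pow-suc k) , inj₁ 4pow-k<y)) }
    where
    P : ℝ → Set
    P v = ∃ λ k → v ≡ pow k × v ≤ y
    1∈P : P 1#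
    1∈P = ℤ.+ 0 , refl , 1≤y
    sup = supremum P (1# , 1∈P) (y , λ _ (_ , _ , v≤y) → v≤y)
    s = proj₁ sup
    bound = proj₁ (proj₂ sup)
    approximated = proj₂ (proj₂ sup)

  pow-cover-<1 : ∀ {y} → 0# < y → y < 1# → ∃ λ k → pow k ≤ y × y ≤ 4# * pow k
  pow-cover-<1 {y} 0<y y<1 =
    -- The infimum appears as minus the supremum `s` of the negated powers. As `s ≤ - y < 0`,
    -- `4# * s` lies below `s`, so some `- pow k` exceeds it. The predecessor of `k` is the witness:
    -- were its power above `y`, its negative would lie in `P` and yet exceed `s`.
    case approximated (4# * s) (4*x<x (≤-<-trans (sup-least approximated -y-bound) (neg<0 0<y))) of
    λ { (_ , (k , refl , y≤pow-k) , 4*s<-pow-k) →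
        let j = ℤ.pred k
            pow-k≡4*pow-j = trans (cong pow (sym (ℤ.suc-pred k))) (pow-suc j)
            -pow-k≡4*-pow-j = trans (cong -_ pow-k≡4*pow-j) (-‿distribʳ-* 4# (pow j))
        in j
         , ≮⇒≥ (λ y<pow-j → <⇒≱ (subst (4# * s <_) -pow-k≡4*-pow-j 4*s<-pow-k)
                 (4*-mono-≤ (bound (- pow j) (j , refl , inj₁ y<pow-j))))
         , subst (y ≤_) pow-k≡4*pow-j y≤pow-k }
    where
    P : ℝ → Set
    P v = ∃ λ k → v ≡ - pow k × y ≤ pow k
    -y-bound : UpperBound P (- y)
    -y-bound _ (_ , refl , y≤pow-k) = neg-mono-≤ y≤pow-k
    sup = supremum P (- 1# , ℤ.+ 0 , refl , inj₁ y<1) (- y , -y-bound)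
    s = proj₁ sup
    bound = proj₁ (proj₂ sup)
    approximated = proj₂ (proj₂ sup)

  pow-cover : ∀ {y} → 0# < y → ∃ λ k → pow k ≤ y × y ≤ 4# * pow k
  pow-cover {y} 0<y with <-≤-connex y 1#
  ... | inj₁ y<1 = pow-cover-<1 0<y y<1
  ... | inj₂ 1≤y = pow-cover-≥1 1≤y

-- The zigzag as a supremum of tents.

module Zigzag (R : RealNumbers) where
  open OrderedField R
  open Search R using (IsTrajectory)

  peak : Maybe ℤ → ℝ
  peak nothing  = 0#
  peak (just k) = pow k

  0≤peak : ∀ j → 0# ≤ peak j
  0≤peak nothing  = ≤-refl
  0≤peak (just k) = inj₁ (pow-positive k)

  peak-gap : ∀ k j → peak j ≤ pow k ⊎ 4# * pow k ≤ peak j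
  peak-gap k nothing  = inj₁ (inj₁ (pow-positive k))
  peak-gap k (just j) = pow-gap k j

  -- v ≤ r - |t - 3r| for a peak r.
  BelowTent : ℝ → ℝ → Set
  BelowTent t v = ∃ λ j → v + (peak j + peak j) ≤ t × v + t ≤ 4# * peak j

  -- The degenerate peak 0 has the tent - |t|, which serves every real `t`, negative ones included.
  belowTent-inhabited : ∀ t → ∃ (BelowTent t)
  belowTent-inhabited t with ≤-total 0# t
  ... | inj₁ 0≤t = - t , nothing
      , ≤-by (+-mono-≤ (+-mono-≤ 0≤t 0≤t) (≤-reflexive (-‿inverseˡ t)))
          (solve 2 (λ n t → n :+ (con 0 :+ con 0) :+ (t :+ t :+ con 0) := con 0 :+ con 0 :+ (n :+ t) :+ t) refl (- t) t)
      , ≤-reflexive (trans (-‿inverseˡ t) (sym (zeroʳ 4#)))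
  ... | inj₂ t≤0 = t , nothing
      , ≤-reflexive (solve 1 (λ t → t :+ (con 0 :+ con 0) := t) refl t)
      , ≤-by (+-mono-≤ t≤0 t≤0)
          (solve 1 (λ t → t :+ t :+ (con 0 :+ con 0) := t :+ t :+ con 4 :* con 0) refl t)

  belowTent-≤ : ∀ t → UpperBound (BelowTent t) t
  belowTent-≤ t v (j , v+2r≤t , _) = ≤-by (+-mono-≤ v+2r≤t (+-mono-≤ (0≤peak j) (0≤peak j)))
    (solve 3 (λ v r t → v :+ (t :+ (r :+ r)) := v :+ (r :+ r) :+ (con 0 :+ con 0) :+ t) refl v (peak j) t)

  private
    tentSupremum : ∀ t → _
    tentSupremum t = supremum (BelowTent t) (belowTent-inhabited t) (t , belowTent-≤ t)

  zigzag : ℝ → ℝ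
  zigzag t = proj₁ (tentSupremum t)

  zigzag-upper : ∀ t → UpperBound (BelowTent t) (zigzag t)
  zigzag-upper t = proj₁ (proj₂ (tentSupremum t))

  zigzag-least : ∀ {t u} → UpperBound (BelowTent t) u → zigzag t ≤ u
  zigzag-least {t} = sup-least (proj₂ (proj₂ (tentSupremum t)))

  zigzag-≡ : ∀ {t v} → BelowTent t v → UpperBound (BelowTent t) v → zigzag t ≡ v
  zigzag-≡ {t} below upper = ≤-antisym (zigzag-least upper) (zigzag-upper t _ below)

  -- A shift by a - b that respects the tents passes to the suprema. Writing it as `w + b ≡ v + a`
  -- keeps subtraction out of the solver calls that use it.
  zigzag-compare : ∀ {s t a b} → (∀ {v w} → w + b ≡ v + a → BelowTent s v → BelowTent t w) →
                   zigzag s + a ≤ zigzag t + b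
  zigzag-compare {s} {t} {a} {b} f =
    subst (zigzag s + a ≤_) (x-y+y≡x (zigzag t + b) a) (+-mono-≤ (zigzag-least upper) ≤-refl)
    where
    upper : UpperBound (BelowTent s) (zigzag t + b - a)
    upper v below = ≤⇒≤-sub (subst (_≤ zigzag t + b) (x-y+y≡x (v + a) b)
      (+-mono-≤ (zigzag-upper t _ (f (x-y+y≡x (v + a) b) below)) ≤-refl))

  -- Tents are 1-Lipschitz: a value lowered by t - s stays below the same tent. `zigzag-ascent`
  -- makes the same move backward in time.
  zigzag-descent : ∀ {s t} → s ≤ t → zigzag s + s ≤ zigzag t + t
  zigzag-descent {s} {t} s≤t = zigzag-compare λ {v} {w} w+t≡v+s (j , v+2r≤s , v+s≤4r) → j
    -- The rising side gains 2(t - s) of slack, hence `s≤t` twice; the falling side is unchanged.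
    , ≤-by (+-mono-≤ (+-mono-≤ v+2r≤s (+-mono-≤ s≤t s≤t)) (≤-reflexive w+t≡v+s))
        (solve 5 (λ v w r s t → w :+ (r :+ r) :+ (s :+ (t :+ t) :+ (v :+ s)) :=
                                v :+ (r :+ r) :+ (s :+ s) :+ (w :+ t) :+ t) refl v w (peak j) s t)
    , subst (_≤ 4# * peak j) (sym w+t≡v+s) v+s≤4r

  zigzag-ascent : ∀ {s t} → s ≤ t → zigzag t + s ≤ zigzag s + t
  zigzag-ascent {s} {t} s≤t = zigzag-compare λ {v} {w} w+t≡v+s (j , v+2r≤t , v+t≤4r) → j
    , ≤-by (+-mono-≤ v+2r≤t (≤-reflexive w+t≡v+s))
        (solve 5 (λ v w r s t → w :+ (r :+ r) :+ (t :+ (v :+ s)) :=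
                                v :+ (r :+ r) :+ (w :+ t) :+ s) refl v w (peak j) s t)
    , ≤-by (+-mono-≤ (+-mono-≤ v+t≤4r (+-mono-≤ s≤t s≤t)) (≤-reflexive w+t≡v+s))
        (solve 5 (λ v w r s t → w :+ s :+ (con 4 :* r :+ (t :+ t) :+ (v :+ s)) :=
                                v :+ t :+ (s :+ s) :+ (w :+ t) :+ con 4 :* r) refl v w (peak j) s t)

  zigzag-origin : zigzag 0# ≡ 0#
  zigzag-origin = zigzag-≡
    (nothing , ≤-reflexive (solve 0 (con 0 :+ (con 0 :+ con 0) := con 0) refl)
             , ≤-reflexive (solve 0 (con 0 :+ con 0 := con 4 :* con 0) refl))
    (belowTent-≤ 0#)

  zigzag-isTrajectory : IsTrajectory zigzag
  zigzag-isTrajectory = record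
    { origin = zigzag-origin
    ; speed  = λ {s} {t} _ s≤t →
          subst (_≤ zigzag t - zigzag s) (sym (⁻¹-anti-homo-// t s))
            (difference-≤ (subst₂ _≤_ (+-comm _ _) refl (zigzag-descent s≤t)))
        , difference-≤ (subst (zigzag t + s ≤_) (+-comm _ _) (zigzag-ascent s≤t))
    }

  -- Visits to both points at distance d by time 9d.

  VisitedBy : ℝ → ℝ → Set
  VisitedBy x b = ∃ λ T → 0# ≤ T × T ≤ b × zigzag T ≡ x

  9*≡ : ∀ d → fromℕ 9 * d ≡ 4# * d + 4# * d + d
  9*≡ d = solve 1 (λ d →
    (con 1 :+ (con 1 :+ (con 1 :+ (con 1 :+ (con 1 :+ (con 1 :+ (con 1 :+ (con 1 :+ (con 1 :+ con 0))))))))) :* d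
      := con 4 :* d :+ con 4 :* d :+ d) refl d

  -- d is reached on the way to the peak 4p, where p ≤ d ≤ 4p.
  zigzag-visits-right : ∀ {d} → 0# < d → VisitedBy d (fromℕ 9 * d)
  zigzag-visits-right {d} 0<d = case pow-cover 0<d of λ (k , p≤d , d≤4p) →
    let p = pow k
        -- The rising side t - 2r of the tent with peak r = 4p equals d at t = 8p + d, and p ≤ d
        -- gives t ≤ 9d.
        t = 4# * p + 4# * p + d
        4*0≤4p = 4*-mono-≤ (inj₁ (pow-positive k))
    in t
     , ≤-by (+-mono-≤ (+-mono-≤ 4*0≤4p 4*0≤4p) (inj₁ 0<d))
         (solve 2 (λ p d → con 0 :+ (con 4 :* p :+ con 4 :* p :+ d) :=
                           con 4 :* con 0 :+ con 4 :* con 0 :+ con 0 :+ (con 4 :* p :+ con 4 :* p :+ d)) refl p d)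
     , subst (t ≤_) (sym (9*≡ d)) (+-mono-≤ (+-mono-≤ (4*-mono-≤ p≤d) (4*-mono-≤ p≤d)) ≤-refl)
     , zigzag-≡
         ( just (ℤ.suc k)
         , subst (λ r → d + (r + r) ≤ t) (sym (pow-suc k)) (≤-reflexive (+-comm d (4# * p + 4# * p)))
         , subst (λ r → d + t ≤ 4# * r) (sym (pow-suc k)) (≤-by (+-mono-≤ d≤4p d≤4p)
             (solve 2 (λ p d → d :+ (con 4 :* p :+ con 4 :* p :+ d) :+ (con 4 :* p :+ con 4 :* p) :=
                               d :+ d :+ con 4 :* (con 4 :* p)) refl p d)))
         λ v (j , v+2r≤t , v+t≤4r) → case peak-gap k j of λ
           -- Earlier tents have come down: 4r - t ≤ 4p - t = - 4p - d, which is below d.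
           { (inj₁ r≤p) → ≤-by
               (+-mono-≤ (+-mono-≤ v+t≤4r (4*-mono-≤ r≤p)) (+-mono-≤ 4*0≤4p (+-mono-≤ (inj₁ 0<d) (inj₁ 0<d))))
               (solve 4 (λ p d v r →
                 v :+ (con 4 :* r :+ con 4 :* p :+ (con 4 :* p :+ (d :+ d))) :=
                 v :+ (con 4 :* p :+ con 4 :* p :+ d) :+ con 4 :* r :+ (con 4 :* con 0 :+ (con 0 :+ con 0)) :+ d)
                 refl p d v (peak j))
           -- From 4p on, t - 2r ≤ t - 8p = d.
           ; (inj₂ 4p≤r) → ≤-by (+-mono-≤ v+2r≤t (+-mono-≤ 4p≤r 4p≤r))
               (solve 4 (λ p d v r →
                 v :+ (con 4 :* p :+ con 4 :* p :+ d :+ (r :+ r)) :=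
                 v :+ (r :+ r) :+ (con 4 :* p :+ con 4 :* p) :+ d)
                 refl p d v (peak j)) }

  -- After the peak p, where p ≤ 2d ≤ 4p, the descent to - 2p meets - d.
  zigzag-visits-left : ∀ {d} → 0# < d → VisitedBy (- d) (fromℕ 9 * d)
  zigzag-visits-left {d} 0<d = case pow-cover 0<d+d of λ (k , p≤d+d , d+d≤4p) →
    let p = pow k
        0≤p = inj₁ (pow-positive k)
        -- The falling side 4p - t of the tent with peak p equals - d here, and p ≤ 2d gives t ≤ 9d.
        t = 4# * p + d
        -d+d≡0 = -‿inverseˡ d
    in t
     , ≤-by (+-mono-≤ (4*-mono-≤ 0≤p) (inj₁ 0<d))
         (solve 2 (λ p d → con 0 :+ (con 4 :* p :+ d) := con 4 :* con 0 :+ con 0 :+ (con 4 :* p :+ d)) refl p d)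
     , subst (t ≤_) (sym (9*≡ d)) (≤-by (4*-mono-≤ p≤d+d)
         (solve 2 (λ p d → con 4 :* p :+ d :+ con 4 :* (d :+ d) :=
                           con 4 :* p :+ (con 4 :* d :+ con 4 :* d :+ d)) refl p d))
     , zigzag-≡
         ( just k
         , ≤-by (+-mono-≤ (≤-reflexive -d+d≡0) (+-mono-≤ (+-mono-≤ 0≤p 0≤p) (+-mono-≤ (inj₁ 0<d) (inj₁ 0<d))))
             (solve 3 (λ p d n → n :+ (p :+ p) :+ (con 0 :+ (p :+ p :+ (d :+ d))) :=
                                 n :+ d :+ (con 0 :+ con 0 :+ (con 0 :+ con 0)) :+ (con 4 :* p :+ d)) refl p d (- d))
         , ≤-by (≤-reflexive -d+d≡0)
             (solve 3 (λ p d n → n :+ (con 4 :* p :+ d) :+ con 0 := n :+ d :+ con 4 :* p) refl p d (- d)))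
         λ v (j , v+2r≤t , v+t≤4r) → case peak-gap k j of λ
           { (inj₁ r≤p) → ≤-by
               (+-mono-≤ (+-mono-≤ v+t≤4r (4*-mono-≤ r≤p)) (≤-reflexive (sym -d+d≡0)))
               (solve 5 (λ p d v r n →
                 v :+ (con 4 :* r :+ con 4 :* p :+ (n :+ d)) :=
                 v :+ (con 4 :* p :+ d) :+ con 4 :* r :+ con 0 :+ n)
                 refl p d v (peak j) (- d))
           -- Later tents have t - 2r ≤ d - 4p, which is at most - d exactly because 2d ≤ 4p.
           ; (inj₂ 4p≤r) → ≤-by
               (+-mono-≤ (+-mono-≤ v+2r≤t (+-mono-≤ 4p≤r 4p≤r)) (+-mono-≤ d+d≤4p (≤-reflexive (sym -d+d≡0))))
               (solve 5 (λ p d v r n →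
                 v :+ (con 4 :* p :+ d :+ (r :+ r) :+ (con 4 :* p :+ (n :+ d))) :=
                 v :+ (r :+ r) :+ (con 4 :* p :+ con 4 :* p) :+ (d :+ d :+ con 0) :+ n)
                 refl p d v (peak j) (- d)) }
    where
    0<d+d : 0# < d + d
    0<d+d = subst (_< d + d) (+-identityˡ 0#) (+-mono-< 0<d 0<d)

-- The search algorithm and its completion time.

module ZigzagSearch (R : RealNumbers) (f n : ℕ) (2f<n : 2 ℕ.* f ℕ.+ 1 ℕ.≤ n) where
  open OrderedField R
  open Zigzag R
  open Search R

  strategy : Strategy n
  strategy = record
    { assigned     = λ _ _ → zigzag
    ; isTrajectory = λ _ _ → zigzag-isTrajectory
    ; causal       = λ _ _ _ → refl
    }

  -- The zigzag ignores messages, so no fixed point has to be solved for: faulty robots do as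
  -- prescribed, and the others announce exactly when `zigzag t ≟ x` succeeds.
  wellPosed : WellPosed f strategy
  wellPosed x x≢0 F ∣F∣≤f m a m-isTrajectory = σ , run , refl , refl , as-prescribed
    where
    σ : Scenario n
    σ = record
      { target    = x
      ; faulty    = F
      ; motion    = λ i t → if does (i ∈? F) then m i t else zigzag t
      ; announces = λ i t → if does (i ∈? F) then a i t else does (zigzag t ≟ x)
      }

    as-prescribed : ∀ i → i ∈ F → ∀ t → 0# ≤ t →
                    Scenario.motion σ i t ≡ m i t × Scenario.announces σ i t ≡ a i t
    as-prescribed i i∈F t _ rewrite dec-true (i ∈? F) i∈F = refl , refl

    run : IsRun f strategy σ
    run = record
      { target≢0     = x≢0
      ; faulty≤f     = ∣F∣≤f
      ; isTrajectory = isTraj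
      ; follows      = follow
      ; truthful     = truth
      }
      where
      isTraj : ∀ i → IsTrajectory (λ t → if does (i ∈? F) then m i t else zigzag t)
      isTraj i with i ∈? F
      ... | yes _ = m-isTrajectory i
      ... | no  _ = zigzag-isTrajectory
      follow : ∀ {i} → i ∉ F → ∀ {t} → 0# ≤ t →
               (if does (i ∈? F) then m i t else zigzag t) ≡ zigzag t
      follow {i} i∉F _ rewrite dec-false (i ∈? F) i∉F = refl
      truth : ∀ {i} → i ∉ F → ∀ {t} → 0# ≤ t →
              (if does (i ∈? F) then a i t else does (zigzag t ≟ x)) ≡ true ⇔
              (if does (i ∈? F) then m i t else zigzag t) ≡ x
      truth {i} i∉F {t} _ rewrite dec-false (i ∈? F) i∉F = mk⇔ to (dec-true (zigzag t ≟ x))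
        where
        to : does (zigzag t ≟ x) ≡ true → zigzag t ≡ x
        to eq with yes e ← zigzag t ≟ x = e

  algorithm : Algorithm n f
  algorithm = record { strategy = strategy ; wellPosed = wellPosed }

  -- Two fault sets have at most 2f < n members together. With different sets this yields certainty;
  -- with the same set twice it yields a reliable finder.
  reliable-in-both : (F F′ : Subset n) → ∣ F ∣ ℕ.≤ f → ∣ F′ ∣ ℕ.≤ f → ∃ λ i → i ∉ F × i ∉ F′
  reliable-in-both F F′ ∣F∣≤f ∣F′∣≤f = outside-both F F′ (begin-strict
    ∣ F ∣ ℕ.+ ∣ F′ ∣ ≤⟨ ℕ.+-mono-≤ ∣F∣≤f ∣F′∣≤f ⟩
    f ℕ.+ f         ≡⟨ cong (f ℕ.+_) (ℕ.+-identityʳ f) ⟨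
    2 ℕ.* f         <⟨ ℕ.m<m+n (2 ℕ.* f) ℕ.z<s ⟩
    2 ℕ.* f ℕ.+ 1   ≤⟨ 2f<n ⟩
    n               ∎)
    where open ℕ.≤-Reasoning

  announcement : ∀ {b} {p : ℝ} → b ≡ true → (if b then just p else nothing) ≡ just p
  announcement refl = refl

  -- A message contains its sender's location, so transcripts that agree on an announcement also
  -- agree on where it was made.
  announcement⁻ : ∀ {b} {p q : ℝ} → (if b then just p else nothing) ≡ just q → b ≡ true × p ≡ q
  announcement⁻ {true} refl = refl , refl

  -- A robot reliable both in σ and in an alternative σ′ with the same
  -- messages announces the target of σ, so it is the target of σ′ as well.
  completed-when-visited : ∀ {σ T} → IsRun f strategy σ → 0# ≤ T →
                           zigzag T ≡ Scenario.target σ → Completed algorithm σ T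
  completed-when-visited {σ} {T} run 0≤T visits = found , certain
    where
    open Scenario
    open IsRun

    at-target : ∀ {i} → i ∉ faulty σ → motion σ i T ≡ target σ
    at-target i∉F = trans (follows run i∉F 0≤T) visits

    announced : ∀ {i} → i ∉ faulty σ → announces σ i T ≡ true
    announced i∉F = Equivalence.from (truthful run i∉F 0≤T) (at-target i∉F)

    found : Found algorithm σ T
    found with i , i∉F , _ ← reliable-in-both (faulty σ) (faulty σ) (faulty≤f run) (faulty≤f run) =
      i , T , i∉F , 0≤T , ≤-refl , at-target i∉F , announced i∉F

    certain : Certain algorithm σ T
    certain σ′ run′ agree
      with i , i∉F , i∉F′ ← reliable-in-both (faulty σ) (faulty σ′) (faulty≤f run) (faulty≤f run′)
      with announced′ , same-place ← announcement⁻
             (trans (sym (agree i T 0≤T ≤-refl)) (announcement (announced i∉F)))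
      = trans (sym (Equivalence.to (truthful run′ i∉F′ 0≤T) announced′))
              (trans same-place (at-target i∉F))

  completed : ∀ d → 0# < d → SearchTimeAtMost algorithm d (fromℕ 9 * d)
  completed d 0<d σ run (inj₁ target≡d) = case zigzag-visits-right 0<d of λ
    (T , 0≤T , T≤9d , visits) →
      T , T≤9d , completed-when-visited run 0≤T (trans visits (sym target≡d))
  completed d 0<d σ run (inj₂ target≡-d) = case zigzag-visits-left 0<d of λ
    (T , 0≤T , T≤9d , visits) →
      T , T≤9d , completed-when-visited run 0≤T (trans visits (sym target≡-d))

open import Data.Nat.Base using (_+_; _*_; _≤_)

theorem1 : (R : RealNumbers) (f n : ℕ) → 2 * f + 1 ≤ n →
    Search.S[_,_]≤_·d R n f (RealNumbers.fromℕ R 9)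
theorem1 R f n 2f<n = algorithm , completed
  where open ZigzagSearch R f n 2f<n
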